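{- Let $d\ge 1$ be an integer and let $H$ be a nonempty connected simple graph, whose vertex set is endowed with the path metric. Then $H$ is $\mathbb{Z}^d$-Kirszbraun if and only if $H$ is $(2d,2)$-Helly.
   Context: All graphs are nonempty, connected and simple (no loops, no multiple edges); they may be infinite. A graph is identified with its vertex set, viewed as a metric space with the path metric. $\mathbb{Z}^d$ denotes the Cayley graph of the group $\mathbb{Z}^d$ with respect to the standard generators, so its path metric is the $\ell_1$ metric. For metric spaces $X,Y$, we say $Y$ is $X$-Kirszbraun if for every subset $A\subset X$ (with the metric restricted from $X$), every $1$-Lipschitz map $f:A\to Y$ has a $1$-Lipschitz extension $X\to Y$. For integers $n\ge m\ge 1$, a graph $H$ is $(n,m)$-Helly (has the $(n,m)$-Helly's property) if for every collection of $n$ (not necessarily distinct) closed balls $B_1,\dots,B_n$ in $H$ of radius $\ge 1$: whenever every subcollection of $m$ of them has nonempty intersection, then $\bigcap_{i=1}^n B_i\neq\varnothing$. -}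

module Defs where

open import Axiom.ExcludedMiddle using (ExcludedMiddle)
open import Data.Fin.Base using (Fin; zero; suc)
open import Data.Fin.Subset using (Subset; ∣_∣; _∈_)
open import Data.Integer.Base as ℤ using (ℤ; 0ℤ; 1ℤ; +_; -_)
import Data.Integer.Properties as ℤ
open import Data.Nat.Base using (ℕ; zero; suc; _+_; _≤_; _≥_; z≤n; s≤s)
import Data.Nat.Properties as ℕ
open import Data.Product.Base using (Σ; Σ-syntax; ∃-syntax; _×_; _,_; proj₁; proj₂)
open import Data.Sum.Base using (_⊎_; inj₁; inj₂; swap)
open import Data.Vec.Base using (Vec; []; _∷_; zipWith; replicate; _[_]≔_)
import Data.Vec.Properties as Vec
open import Function.Base using (_∘_; _on_)
open import Function.Metric.Nat using (DistanceFunction; Metric)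
open import Level using (Level; 0ℓ; _⊔_) renaming (suc to lsuc)
open import Relation.Binary.Construct.Closure.ReflexiveTransitive using (Star; ε; _◅_; _◅◅_; gmap; reverse; revApp)
open import Relation.Binary.Core using (Rel)
open import Relation.Binary.Definitions using (Symmetric; Irreflexive)
open import Relation.Binary.PropositionalEquality
  using (_≡_; _≢_; refl; sym; trans; cong; cong₂; subst; isEquivalence)
open import Relation.Nullary.Decidable.Core using (yes; no)
open import Relation.Nullary.Negation using (contradiction)
open import Relation.Unary using (Pred)

private
  variable
    a b v e p ℓ₁ ℓ₂ : Level
    A B : Set a

-- Every graph considered here is nonempty, connected and simple.
record Graph v e : Set (lsuc (v ⊔ e)) where
  infix 4 _~_
  field
    Vertex      : Set v
    _~_         : Rel Vertex e
    symmetric   : Symmetric _~_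
    irreflexive : Irreflexive _≡_ _~_
    nonempty    : Vertex
    connected   : ∀ x y → Star _~_ x y

length : {_~_ : Rel A e} {x y : A} → Star _~_ x y → ℕ
length ε        = 0
length (_ ◅ xs) = suc (length xs)

length-◅◅ : {_~_ : Rel A e} {x y z : A} (xs : Star _~_ x y) (ys : Star _~_ y z) →
            length (xs ◅◅ ys) ≡ length xs + length ys
length-◅◅ ε        ys = refl
length-◅◅ (x ◅ xs) ys = cong suc (length-◅◅ xs ys)

length-revApp : {_~_ : Rel A e} (s : Symmetric _~_) {x y z : A}
                (xs : Star _~_ y x) (ys : Star _~_ y z) →
                length (revApp s xs ys) ≡ length xs + length ys
length-revApp s ε        ys = refl
length-revApp s (x ◅ xs) ys =
  trans (length-revApp s xs (s x ◅ ys)) (ℕ.+-suc (length xs) (length ys))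

length-reverse : {_~_ : Rel A e} (s : Symmetric _~_) {x y : A} (xs : Star _~_ x y) →
                 length (reverse s xs) ≡ length xs
length-reverse s xs = trans (length-revApp s xs ε) (ℕ.+-identityʳ (length xs))

record Least (P : Pred ℕ p) : Set p where
  field
    value   : ℕ
    holds   : P value
    minimal : ∀ {n} → P n → value ≤ n

least : ExcludedMiddle p → (P : Pred ℕ p) (n : ℕ) → P n → Least P
least em P zero Pn = record { value = 0 ; holds = Pn ; minimal = λ _ → z≤n }
least em P (suc n) Pn with em {P 0}
... | yes P0 = record { value = 0 ; holds = P0 ; minimal = λ _ → z≤n }
... | no ¬P0 = record
  { value   = suc L.value
  ; holds   = L.holds
  ; minimal = λ { {zero} P0 → contradiction P0 ¬P0 ; {suc _} Pk → s≤s (L.minimal Pk) }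
  }
  where module L = Least (least em (P ∘ suc) n Pn)

-- Adjacency in an arbitrary graph is undecidable, so the minimum defining the
-- path metric exists only classically; this is why excluded middle is an argument.
module _ (em : ∀ ℓ → ExcludedMiddle ℓ) (G : Graph v e) where
  open Graph G

  walkLengths : Vertex → Vertex → Pred ℕ (v ⊔ e)
  walkLengths x y n = Σ[ w ∈ Star _~_ x y ] length w ≡ n

  leastLength : ∀ x y → Least (walkLengths x y)
  leastLength x y = least (em (v ⊔ e)) (walkLengths x y) (length w) (w , refl)
    where w = connected x y

  dist : DistanceFunction Vertex
  dist x y = Least.value (leastLength x y)

  geodesic : ∀ x y → Σ[ w ∈ Star _~_ x y ] length w ≡ dist x y
  geodesic x y = Least.holds (leastLength x y)

  dist≤length : ∀ {x y} (w : Star _~_ x y) → dist x y ≤ length w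
  dist≤length {x} {y} w = Least.minimal (leastLength x y) (w , refl)

  dist-refl : ∀ {x y} → x ≡ y → dist x y ≡ 0
  dist-refl refl = ℕ.n≤0⇒n≡0 (dist≤length ε)

  dist-0 : ∀ {x y} → dist x y ≡ 0 → x ≡ y
  dist-0 {x} {y} eq with geodesic x y
  ... | ε     , _  = refl
  ... | _ ◅ _ , eq′ with () ← trans eq′ eq

  dist-sym-≤ : ∀ x y → dist x y ≤ dist y x
  dist-sym-≤ x y with geodesic y x
  ... | w , eq = subst (dist x y ≤_) (trans (length-reverse symmetric w) eq)
                       (dist≤length (reverse symmetric w))

  dist-triangle : ∀ x y z → dist x z ≤ dist x y + dist y z
  dist-triangle x y z with geodesic x y | geodesic y z
  ... | w , eq | w′ , eq′ = subst (dist x z ≤_) (trans (length-◅◅ w w′) (cong₂ _+_ eq eq′))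
                                  (dist≤length (w ◅◅ w′))

  pathMetric : Metric v v
  pathMetric = record
    { Carrier  = Vertex
    ; _≈_      = _≡_
    ; d        = dist
    ; isMetric = record
      { isSemiMetric = record
        { isQuasiSemiMetric = record
          { isPreMetric = record
            { isProtoMetric = record
              { isPartialOrder  = ℕ.≤-isPartialOrder
              ; ≈-isEquivalence = isEquivalence
              ; cong            = cong₂ dist
              ; nonNegative     = z≤n
              }
            ; ≈⇒0 = dist-refl
            }
          ; 0⇒≈ = dist-0
          }
        ; sym = λ x y → ℕ.≤-antisym (dist-sym-≤ x y) (dist-sym-≤ y x)
        }
      ; triangle = dist-triangle
      }
    }

infixl 6 _+ᵛ_
_+ᵛ_ : ∀ {d} → Vec ℤ d → Vec ℤ d → Vec ℤ d
_+ᵛ_ = zipWith ℤ._+_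

unit : ∀ {d} → Fin d → Vec ℤ d
unit {d} i = replicate d 0ℤ [ i ]≔ 1ℤ

CayleyAdj : ∀ {d} → Vec ℤ d → Vec ℤ d → Set
CayleyAdj x y = ∃[ i ] (y ≡ x +ᵛ unit i ⊎ x ≡ y +ᵛ unit i)

adj-sym : ∀ {d} → Symmetric (CayleyAdj {d})
adj-sym (i , s) = i , swap s

x≢x+unit : ∀ {d} (x : Vec ℤ d) i → x ≢ x +ᵛ unit i
x≢x+unit (c ∷ _) zero    eq = ℤ.i≢suc[i] (trans (Vec.∷-injectiveˡ eq) (ℤ.+-comm c 1ℤ))
x≢x+unit (_ ∷ x) (suc i) eq = x≢x+unit x i (Vec.∷-injectiveʳ eq)

adj-irrefl : ∀ {d} → Irreflexive _≡_ (CayleyAdj {d})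
adj-irrefl {x = x} refl (i , inj₁ eq) = x≢x+unit x i eq
adj-irrefl {x = x} refl (i , inj₂ eq) = x≢x+unit x i eq

+ᵛ-identityʳ : ∀ {d} (x : Vec ℤ d) → x ≡ x +ᵛ replicate d 0ℤ
+ᵛ-identityʳ x = sym (Vec.zipWith-identityʳ ℤ.+-identityʳ x)

adj-∷ : ∀ {d} c {x y : Vec ℤ d} → CayleyAdj x y → CayleyAdj (c ∷ x) (c ∷ y)
adj-∷ c (i , inj₁ eq) = suc i , inj₁ (cong₂ _∷_ (sym (ℤ.+-identityʳ c)) eq)
adj-∷ c (i , inj₂ eq) = suc i , inj₂ (cong₂ _∷_ (sym (ℤ.+-identityʳ c)) eq)

up : ∀ {d} (x : Vec ℤ d) c n → Star CayleyAdj (c ∷ x) (c ℤ.+ (+ n) ∷ x)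
up x c zero    = subst (λ k → Star CayleyAdj (c ∷ x) (k ∷ x)) (sym (ℤ.+-identityʳ c)) ε
up x c (suc n) =
  (zero , inj₁ (cong₂ _∷_ refl (+ᵛ-identityʳ x)))
  ◅ subst (λ k → Star CayleyAdj (c ℤ.+ 1ℤ ∷ x) (k ∷ x)) (ℤ.+-assoc c 1ℤ (+ n)) (up x (c ℤ.+ 1ℤ) n)

up-≤ : ∀ {d} (x : Vec ℤ d) {c c′} → c ℤ.≤ c′ → Star CayleyAdj (c ∷ x) (c′ ∷ x)
up-≤ x {c} {c′} c≤c′ =
  subst (λ k → Star CayleyAdj (c ∷ x) (k ∷ x)) eq (up x c ℤ.∣ c′ ℤ.- c ∣)
  where
  eq : c ℤ.+ (+ ℤ.∣ c′ ℤ.- c ∣) ≡ c′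
  eq = trans (cong (λ k → c ℤ.+ k) (ℤ.0≤i⇒+∣i∣≡i (ℤ.i≤j⇒0≤j-i c≤c′)))
             (trans (ℤ.+-comm c (c′ ℤ.- c))
               (trans (ℤ.+-assoc c′ (- c) c)
                 (trans (cong (λ k → c′ ℤ.+ k) (ℤ.+-inverseˡ c)) (ℤ.+-identityʳ c′))))

adj-connected : ∀ {d} (x y : Vec ℤ d) → Star CayleyAdj x y
adj-connected []      []       = ε
adj-connected (c ∷ x) (c′ ∷ y) = first ◅◅ gmap (c′ ∷_) (adj-∷ c′) (adj-connected x y)
  where
  first : Star CayleyAdj (c ∷ x) (c′ ∷ x)
  first with ℤ.≤-total c c′
  ... | inj₁ c≤c′ = up-≤ x c≤c′
  ... | inj₂ c′≤c = reverse adj-sym (up-≤ x c′≤c)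

ℤ^_ : ℕ → Graph 0ℓ 0ℓ
ℤ^ d = record
  { Vertex      = Vec ℤ d
  ; _~_         = CayleyAdj
  ; symmetric   = adj-sym
  ; irreflexive = adj-irrefl
  ; nonempty    = replicate d 0ℤ
  ; connected   = adj-connected
  }

1-Lipschitz : DistanceFunction A → DistanceFunction B → (A → B) → Set _
1-Lipschitz dᴬ dᴮ f = ∀ x y → dᴮ (f x) (f y) ≤ dᴬ x y

-- Y is X-Kirszbraun.
Kirszbraun : Metric a ℓ₁ → Metric b ℓ₂ → Set _
Kirszbraun {a = a} X Y =
  (S : Pred X.Carrier a) (f : Σ X.Carrier S → Y.Carrier) →
  1-Lipschitz (X.d on proj₁) Y.d f →
  Σ[ g ∈ (X.Carrier → Y.Carrier) ]
    1-Lipschitz X.d Y.d g × (∀ x (x∈S : S x) → g x Y.≈ f (x , x∈S))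
  where
  module X = Metric X
  module Y = Metric Y

ClosedBall : (M : Metric a ℓ₁) → Metric.Carrier M → ℕ → Pred (Metric.Carrier M) _
ClosedBall M c r x = Metric.d M x c ≤ r

-- The distances are integers, so a ball of real radius r ≥ 1 is the ball of
-- radius ⌊ r ⌋ ≥ 1 with the same centre.
Helly : ℕ → ℕ → Metric a ℓ₁ → Set _
Helly n m M =
  (c : Fin n → Carrier) (r : Fin n → ℕ) → (∀ i → r i ≥ 1) →
  (∀ (I : Subset n) → ∣ I ∣ ≡ m → ∃[ x ] (∀ i → i ∈ I → ClosedBall M (c i) (r i) x)) →
  ∃[ x ] (∀ i → ClosedBall M (c i) (r i) x)
  where open Metric M using (Carrier)

{-# OPTIONS --safe #-}
module Submission where

-- Put the i-th of 2d points at distance r_i from the origin, one on each half-axis.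
-- Their distances are the sums r_i + r_j, so sending them to the centres of 2d
-- pairwise intersecting balls of radii r_i is 1-Lipschitz, and the value of an
-- extension at the origin is a common point of the balls.
--
-- Conversely it suffices to extend by one point b at a time, and by Dickson's
-- lemma only finitely many points of the domain matter for b: a point a is
-- redundant if a geodesic from b to a passes through another one.  Families of
-- 2d points extend by the Helly property.  In a family of more than 2d points,
-- some a is not among 2d chosen points that maximise and minimise the
-- coordinates.  The map is defined at a; change a into b one coordinate at a
-- time.  When the j-th coordinate leaves that of a, the current point x lies on
-- geodesics from its successor both to a and to the chosen extreme point on the
-- other side, so x can replace these two and the family becomes smaller.

open import Defs
open import Axiom.ExcludedMiddle using (ExcludedMiddle)
open import Data.Fin.Base using (Fin; zero; suc; punchIn; punchOut; pinch; combine; remQuot)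
import Data.Fin.Properties as Fin
open import Data.Fin.Subset using (Subset; inside; outside; ∣_∣; _∈_; ⁅_⁆; _∪_)
import Data.Fin.Subset.Properties as Subset
open import Data.Integer.Base as ℤ using (ℤ; 0ℤ; 1ℤ; +_; -[1+_]; -_; _⊖_)
import Data.Integer.Properties as ℤ
open import Data.List.Base as List using (List; []; _∷_; _++_)
import Data.List.Extrema.Nat as Extrema
open import Data.List.Membership.Propositional using (find; lose)
open import Data.List.Relation.Unary.All as All using (All)
import Data.List.Relation.Unary.All.Properties as All
open import Data.List.Relation.Unary.Any as Any using (Any; here)
import Data.List.Relation.Unary.Any.Properties as Any
open import Data.Nat.Base using (ℕ; zero; suc; _+_; _*_; _≤_; _<_; _⊔_; z≤n; s≤s; _≤′_; ≤′-refl; ≤′-step)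
import Data.Nat.Properties as ℕ
open import Algebra.Properties.CommutativeSemigroup ℕ.+-commutativeSemigroup using (interchange)
open import Data.Product.Base using (Σ; Σ-syntax; ∃-syntax; _×_; _,_; proj₁; proj₂; uncurry)
open import Data.Product.Function.NonDependent.Propositional using (_×-↠_)
open import Data.Sum.Base as Sum using (_⊎_; inj₁; inj₂; [_,_]′)
open import Data.Vec.Base using (Vec; []; _∷_; lookup; replicate; _[_]≔_; here; there)
import Data.Vec.Functional as Vector
import Data.Vec.Functional.Properties as Vector
open import Function.Base using (_∘_; _on_; const; flip)
open import Function.Bundles using (_⇔_; mk⇔; _↠_; mk↠ₛ; module Surjection)
open import Function.Construct.Composition using (_↠-∘_)
open import Function.Metric.Nat using (Metric)
open import Level using (Level; 0ℓ)
open import Relation.Binary.Construct.Closure.ReflexiveTransitive using (Star; ε; _◅_; _◅◅_; gmap; reverse)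
open import Relation.Binary.Core using (Rel)
open import Relation.Binary.Definitions using (Total; Transitive)
open import Relation.Binary.PropositionalEquality
  using (_≡_; _≢_; refl; sym; trans; cong; cong₂; subst; subst₂; module ≡-Reasoning)
open import Relation.Nullary.Decidable.Core using (yes; no)
open import Relation.Nullary.Negation using (¬_; contradiction)
open import Relation.Unary using (Pred; U)

private
  variable
    a b v e p ℓ₁ ℓ₂ : Level
    A B : Set a
    d n : ℕ

-- The ℓ₁ metric

δ : ℤ → ℤ → ℕ
δ i j = ℤ.∣ i ℤ.- j ∣

δ-refl : ∀ i → δ i i ≡ 0
δ-refl i = cong ℤ.∣_∣ (ℤ.+-inverseʳ i)

δ-triangle : ∀ i j k → δ i k ≤ δ i j + δ j k
δ-triangle i j k = subst (λ u → ℤ.∣ u ∣ ≤ δ i j + δ j k) (ℤ.+-minus-telescope i j k)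
                         (ℤ.∣i+j∣≤∣i∣+∣j∣ (i ℤ.- j) (j ℤ.- k))

-- For descending arguments the absolute values are plain differences, which telescope in `ℤ`.
δ-descending : ∀ {i j k} → k ℤ.≤ j → j ℤ.≤ i → δ i j + δ j k ≡ δ i k
δ-descending {i} {j} {k} k≤j j≤i = ℤ.+-injective (begin
  + (δ i j + δ j k)         ≡⟨ ℤ.pos-+ (δ i j) (δ j k) ⟩
  + δ i j ℤ.+ + δ j k       ≡⟨ cong₂ ℤ._+_ (+δ j≤i) (+δ k≤j) ⟩
  (i ℤ.- j) ℤ.+ (j ℤ.- k)   ≡⟨ ℤ.+-minus-telescope i j k ⟩
  i ℤ.- k                   ≡⟨ +δ (ℤ.≤-trans k≤j j≤i) ⟨
  + δ i k                   ∎)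
  where
  open ≡-Reasoning
  +δ : ∀ {x y} → y ℤ.≤ x → + δ x y ≡ x ℤ.- y
  +δ y≤x = ℤ.0≤i⇒+∣i∣≡i (ℤ.i≤j⇒0≤j-i y≤x)

Between : ℤ → ℤ → ℤ → Set
Between i j k = (i ℤ.≤ j × j ℤ.≤ k) ⊎ (k ℤ.≤ j × j ℤ.≤ i)

δ-between : ∀ {i j k} → Between i j k → δ i j + δ j k ≡ δ i k
δ-between {i} {j} {k} (inj₁ (i≤j , j≤k)) = begin
  δ i j + δ j k  ≡⟨ cong₂ _+_ (ℤ.∣i-j∣≡∣j-i∣ i j) (ℤ.∣i-j∣≡∣j-i∣ j k) ⟩
  δ j i + δ k j  ≡⟨ ℕ.+-comm (δ j i) (δ k j) ⟩
  δ k j + δ j i  ≡⟨ δ-descending i≤j j≤k ⟩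
  δ k i          ≡⟨ ℤ.∣i-j∣≡∣j-i∣ k i ⟩
  δ i k          ∎
  where open ≡-Reasoning
δ-between (inj₂ (k≤j , j≤i)) = δ-descending k≤j j≤i

l1 : Vec ℤ d → Vec ℤ d → ℕ
l1 []      []      = 0
l1 (i ∷ x) (j ∷ y) = δ i j + l1 x y

l1-refl : (x : Vec ℤ d) → l1 x x ≡ 0
l1-refl []      = refl
l1-refl (i ∷ x) = cong₂ _+_ (δ-refl i) (l1-refl x)

l1-sym : (x y : Vec ℤ d) → l1 x y ≡ l1 y x
l1-sym []      []      = refl
l1-sym (i ∷ x) (j ∷ y) = cong₂ _+_ (ℤ.∣i-j∣≡∣j-i∣ i j) (l1-sym x y)

l1-triangle : (x y z : Vec ℤ d) → l1 x z ≤ l1 x y + l1 y z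
l1-triangle []      []      []      = z≤n
l1-triangle (i ∷ x) (j ∷ y) (k ∷ z) =
  subst (δ i k + l1 x z ≤_) (interchange (δ i j) (δ j k) (l1 x y) (l1 y z))
        (ℕ.+-mono-≤ (δ-triangle i j k) (l1-triangle x y z))

-- Only coordinate `j` changes, and all others contribute `0` to the first summand. Thus `x` lies on
-- a geodesic from its modification to `y`.
l1-[]≔ : (x y : Vec ℤ d) (j : Fin d) {i : ℤ} → Between i (lookup x j) (lookup y j) →
         l1 (x [ j ]≔ i) x + l1 x y ≡ l1 (x [ j ]≔ i) y
l1-[]≔ (k ∷ x) (l ∷ y) zero {i} btw = begin
  (δ i k + l1 x x) + (δ k l + l1 x y)  ≡⟨ interchange (δ i k) (l1 x x) (δ k l) (l1 x y) ⟩
  (δ i k + δ k l) + (l1 x x + l1 x y)  ≡⟨ cong₂ _+_ (δ-between btw) (cong (_+ l1 x y) (l1-refl x)) ⟩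
  δ i l + l1 x y                       ∎
  where open ≡-Reasoning
l1-[]≔ (k ∷ x) (l ∷ y) (suc j) {i} btw = begin
  (δ k k + l1 (x [ j ]≔ i) x) + (δ k l + l1 x y)  ≡⟨ interchange (δ k k) _ (δ k l) _ ⟩
  (δ k k + δ k l) + (l1 (x [ j ]≔ i) x + l1 x y)  ≡⟨ cong₂ _+_ (cong (_+ δ k l) (δ-refl k)) (l1-[]≔ x y j btw) ⟩
  δ k l + l1 (x [ j ]≔ i) y                       ∎
  where open ≡-Reasoning

-- The path metric of ℤ^d is the ℓ₁ metric

l1-+unit : (x : Vec ℤ d) (i : Fin d) → l1 x (x +ᵛ unit i) ≡ 1
l1-+unit (k ∷ x) zero    = cong₂ _+_ δ-suc (trans (cong (l1 x) (sym (+ᵛ-identityʳ x))) (l1-refl x))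
  where
  δ-suc : δ k (k ℤ.+ 1ℤ) ≡ 1
  δ-suc = trans (ℤ.∣i-j∣≡∣j-i∣ k (k ℤ.+ 1ℤ))
                (cong ℤ.∣_∣ (trans (cong (ℤ._- k) (ℤ.+-comm k 1ℤ))
                                   (trans (ℤ.+-assoc 1ℤ k (- k)) (cong (λ u → 1ℤ ℤ.+ u) (ℤ.+-inverseʳ k)))))
l1-+unit (k ∷ x) (suc i) =
  cong₂ _+_ (trans (cong (δ k) (ℤ.+-identityʳ k)) (δ-refl k)) (l1-+unit x i)

l1-adjacent : {x y : Vec ℤ d} → CayleyAdj x y → l1 x y ≡ 1
l1-adjacent {x = x}     (i , inj₁ refl) = l1-+unit x i
l1-adjacent {x = x} {y} (i , inj₂ refl) = trans (l1-sym x y) (l1-+unit y i)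

-- Each edge has ℓ₁ length 1, so the triangle inequality along the walk gives the lower bound on
-- path distance.
l1≤length : {x y : Vec ℤ d} (w : Star CayleyAdj x y) → l1 x y ≤ length w
l1≤length {x = x} ε = ℕ.≤-reflexive (l1-refl x)
l1≤length {x = x} {z} (_◅_ {j = y} xy w) =
  ℕ.≤-trans (l1-triangle x y z) (ℕ.+-mono-≤ (ℕ.≤-reflexive (l1-adjacent xy)) (l1≤length w))

length-subst : {_~_ : A → A → Set e} (f : B → A) {x : A} {y z : B} (eq : y ≡ z) (w : Star _~_ x (f y)) →
               length (subst (λ k → Star _~_ x (f k)) eq w) ≡ length w
length-subst f refl w = refl

length-up : (x : Vec ℤ d) (c : ℤ) (n : ℕ) → length (up x c n) ≡ n
length-up x c zero    = length-subst (_∷ x) (sym (ℤ.+-identityʳ c)) ε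
length-up x c (suc n) = cong suc (trans (length-subst (_∷ x) (ℤ.+-assoc c 1ℤ (+ n)) _) (length-up x (c ℤ.+ 1ℤ) n))

length-up-≤ : (x : Vec ℤ d) {c c′ : ℤ} (c≤c′ : c ℤ.≤ c′) → length (up-≤ x c≤c′) ≡ δ c′ c
length-up-≤ x {c} {c′} c≤c′ = trans (length-subst (_∷ x) _ (up x c (δ c′ c))) (length-up x c (δ c′ c))

length-gmap : {R : A → A → Set a} {S : B → B → Set b} {f : A → B} {g : ∀ {x y} → R x y → S (f x) (f y)}
              {x y : A} (w : Star R x y) → length (gmap {U = S} f g w) ≡ length w
length-gmap         ε       = refl
length-gmap {S = S} (_ ◅ w) = cong suc (length-gmap {S = S} w)

-- The matching upper bound: the coordinates are corrected one after the other, each by a monotone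
-- walk.
l1-walk : (x y : Vec ℤ d) → Σ[ w ∈ Star CayleyAdj x y ] length w ≡ l1 x y
l1-walk []      []       = ε , refl
l1-walk (c ∷ x) (c′ ∷ y) with l1-walk x y | ℤ.≤-total c c′
... | w , eq | inj₁ c≤c′ =
  up-≤ x c≤c′ ◅◅ gmap (c′ ∷_) (adj-∷ c′) w ,
  trans (length-◅◅ (up-≤ x c≤c′) _)
        (cong₂ _+_ (trans (length-up-≤ x c≤c′) (ℤ.∣i-j∣≡∣j-i∣ c′ c)) (trans (length-gmap w) eq))
... | w , eq | inj₂ c′≤c =
  reverse adj-sym (up-≤ x c′≤c) ◅◅ gmap (c′ ∷_) (adj-∷ c′) w ,
  trans (length-◅◅ (reverse adj-sym (up-≤ x c′≤c)) _)
        (cong₂ _+_ (trans (length-reverse adj-sym (up-≤ x c′≤c)) (length-up-≤ x c′≤c)) (trans (length-gmap w) eq))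

dist≡l1 : (em : ∀ ℓ → ExcludedMiddle ℓ) (x y : Vec ℤ d) → dist em (ℤ^ d) x y ≡ l1 x y
dist≡l1 {d} em x y with l1-walk x y | geodesic em (ℤ^ d) x y
... | w , eq | w′ , eq′ = ℕ.≤-antisym
  (subst (dist em (ℤ^ d) x y ≤_) eq (dist≤length em (ℤ^ d) w))
  (subst (l1 x y ≤_) eq′ (l1≤length w′))

-- Pairwise conditions on balls

∣⁅i⁆∪⁅j⁆∣≡2 : {i j : Fin n} → i ≢ j → ∣ ⁅ i ⁆ ∪ ⁅ j ⁆ ∣ ≡ 2
∣⁅i⁆∪⁅j⁆∣≡2 {i = zero}  {zero}  0≢0 = contradiction refl 0≢0
∣⁅i⁆∪⁅j⁆∣≡2 {i = zero}  {suc j} _   =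
  cong suc (trans (cong ∣_∣ (Subset.∪-identityˡ ⁅ j ⁆)) (Subset.∣⁅x⁆∣≡1 j))
∣⁅i⁆∪⁅j⁆∣≡2 {i = suc i} {zero}  _   =
  cong suc (trans (cong ∣_∣ (Subset.∪-identityʳ ⁅ i ⁆)) (Subset.∣⁅x⁆∣≡1 i))
∣⁅i⁆∪⁅j⁆∣≡2 {i = suc i} {suc j} i≢j = ∣⁅i⁆∪⁅j⁆∣≡2 (i≢j ∘ cong suc)

∣I∣≡0⇒∉ : {I : Subset n} → ∣ I ∣ ≡ 0 → ∀ {k} → ¬ (k ∈ I)
∣I∣≡0⇒∉ {I = outside ∷ I} eq (there k∈I) = ∣I∣≡0⇒∉ eq k∈I

∣I∣≡1⇒singleton : {I : Subset n} → ∣ I ∣ ≡ 1 → ∃[ i ] (∀ {k} → k ∈ I → k ≡ i)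
∣I∣≡1⇒singleton {I = inside ∷ I} eq = zero , λ where
  here        → refl
  (there k∈I) → contradiction k∈I (∣I∣≡0⇒∉ (ℕ.suc-injective eq))
∣I∣≡1⇒singleton {I = outside ∷ I} eq with ∣I∣≡1⇒singleton eq
... | i , only = suc i , λ { (there k∈I) → cong suc (only k∈I) }

∣I∣≡2⇒pair : {I : Subset n} → ∣ I ∣ ≡ 2 → ∃[ i ] ∃[ j ] (∀ {k} → k ∈ I → k ≡ i ⊎ k ≡ j)
∣I∣≡2⇒pair {I = inside ∷ I} eq with ∣I∣≡1⇒singleton (ℕ.suc-injective eq)
... | j , only = zero , suc j , λ where
  here        → inj₁ refl
  (there k∈I) → inj₂ (cong suc (only k∈I))
∣I∣≡2⇒pair {I = outside ∷ I} eq with ∣I∣≡2⇒pair eq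
... | i , j , only = suc i , suc j , λ { (there k∈I) → Sum.map (cong suc) (cong suc) (only k∈I) }

-- The hypothesis says that any two of the balls meet if the metric is a path metric.
PairwiseHelly : ℕ → Metric a ℓ₁ → Set a
PairwiseHelly n M = (c : Fin n → Carrier) (r : Fin n → ℕ) → (∀ i j → dᴹ (c i) (c j) ≤ r i + r j) →
                    ∃[ x ] (∀ i → dᴹ x (c i) ≤ r i)
  where open Metric M using (Carrier) renaming (d to dᴹ)

pairwiseHelly⇒Helly : (M : Metric a ℓ₁) → PairwiseHelly n M → Helly n 2 M
pairwiseHelly⇒Helly M helly c r _ meet = helly c r close
  where
  module M = Metric M
  close : ∀ i j → M.d (c i) (c j) ≤ r i + r j
  close i j with i Fin.≟ j
  -- Subsets of size 2 only provide pairs of distinct indices; on the diagonal the distance is 0.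
  ... | yes refl = ℕ.≤-trans (ℕ.≤-reflexive (M.≈⇒0 M.EqC.refl)) z≤n
  ... | no i≢j with meet (⁅ i ⁆ ∪ ⁅ j ⁆) (∣⁅i⁆∪⁅j⁆∣≡2 i≢j)
  ...   | x , x∈ = ℕ.≤-trans (M.triangle (c i) x (c j)) (ℕ.+-mono-≤
    (subst (_≤ r i) (M.sym x (c i)) (x∈ i (Subset.x∈p∪q⁺ (inj₁ (Subset.x∈⁅x⁆ i)))))
    (x∈ j (Subset.x∈p∪q⁺ (inj₂ (Subset.x∈⁅x⁆ j)))))

module _ (em : ∀ ℓ → ExcludedMiddle ℓ) (H : Graph v e) where
  open Graph H

  -- The point `z` is reached after `r` steps, or is the end of the walk if it is shorter. Applied
  -- to a geodesic, this makes balls meet when their centres are at most the sum of the radii apart.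
  split-walk : ∀ r s {x y} (w : Star _~_ x y) → length w ≤ r + s →
               ∃[ z ] (dist em H z x ≤ r × dist em H z y ≤ s)
  split-walk zero    s {x} w         w≤s   = x , dist≤length em H ε , ℕ.≤-trans (dist≤length em H w) w≤s
  split-walk (suc r) s {x} ε         _     = x , x-near , x-near
    where
    x-near : ∀ {t} → dist em H x x ≤ t
    x-near = ℕ.≤-trans (dist≤length em H ε) z≤n
  split-walk (suc r) s {x} (_◅_ {j = x′} xx′ w) (s≤s w≤) with split-walk r s w w≤
  ... | z , zx′≤r , zy≤s = z ,
    ℕ.≤-trans (dist-triangle em H z x′ x)
      (ℕ.≤-trans (ℕ.+-mono-≤ zx′≤r (dist≤length em H (symmetric xx′ ◅ ε)))
                 (ℕ.≤-reflexive (ℕ.+-comm r 1))) ,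
    zy≤s

  Helly⇒pairwiseHelly : Helly n 2 (pathMetric em H) → PairwiseHelly n (pathMetric em H)
  Helly⇒pairwiseHelly helly c r close with Fin.any? (λ i → r i ℕ.≟ 0)
  -- `Helly` speaks of radii at least 1. If some radius is 0, the centre of that ball is the only
  -- candidate, and the pairwise bounds put it in every other ball.
  ... | yes (i , rᵢ≡0) = c i , λ j → subst (λ k → dist em H (c i) (c j) ≤ k + r j) rᵢ≡0 (close i j)
  ... | no r≢0 = helly c r (λ i → ℕ.n≢0⇒n>0 (r≢0 ∘ (i ,_))) meet
    where
    meet : ∀ I → ∣ I ∣ ≡ 2 → ∃[ x ] (∀ i → i ∈ I → dist em H x (c i) ≤ r i)
    meet I ∣I∣≡2 with ∣I∣≡2⇒pair ∣I∣≡2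
    ... | i , j , only with geodesic em H (c i) (c j)
    ... | w , eq with split-walk (r i) (r j) w (subst (_≤ r i + r j) (sym eq) (close i j))
    ... | x , xᵢ , xⱼ = x , λ k k∈I → [ (λ { refl → xᵢ }) , (λ { refl → xⱼ }) ]′ (only k∈I)

-- Kirszbraun property from one-point extensions

OnePointExtension : Metric a ℓ₁ → Metric b ℓ₂ → Set _
OnePointExtension {a = a} X Y =
  (S : Pred X.Carrier a) (f : Σ X.Carrier S → Y.Carrier) → 1-Lipschitz (X.d on proj₁) Y.d f →
  ∀ x → ∃[ y ] (∀ s → Y.d y (f s) ≤ X.d x (proj₁ s))
  where
  module X = Metric X
  module Y = Metric Y

module _ (X : Metric a ℓ₁) (Y : Metric b ℓ₂) where
  private
    module X = Metric X
    module Y = Metric Y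

  record PartialMap : Set (Level.suc a Level.⊔ b) where
    field
      Dom       : Pred X.Carrier a
      map       : Σ X.Carrier Dom → Y.Carrier
      lipschitz : 1-Lipschitz (X.d on proj₁) Y.d map
  open PartialMap

  module _ (extend : OnePointExtension X Y) where

    extendAt : PartialMap → X.Carrier → PartialMap
    extendAt φ b = record { Dom = Dom′ ; map = map′ ; lipschitz = lipschitz′ }
      where
      new : ∃[ y ] (∀ s → Y.d y (map φ s) ≤ X.d b (proj₁ s))
      new = extend (Dom φ) (map φ) (lipschitz φ) b
      -- If `b` was already in the domain it now has two memberships; `lipschitz′` forces their
      -- values to be at distance 0.
      Dom′ : Pred X.Carrier a
      Dom′ x = Dom φ x ⊎ b ≡ x
      map′ : Σ X.Carrier Dom′ → Y.Carrier
      map′ (x , inj₁ x∈) = map φ (x , x∈)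
      map′ (x , inj₂ _)  = proj₁ new
      lipschitz′ : 1-Lipschitz (X.d on proj₁) Y.d map′
      lipschitz′ (x , inj₁ x∈)   (y , inj₁ y∈)   = lipschitz φ (x , x∈) (y , y∈)
      lipschitz′ (x , inj₁ x∈)   (y , inj₂ refl) = subst₂ _≤_ (Y.sym _ _) (X.sym _ _) (proj₂ new (x , x∈))
      lipschitz′ (x , inj₂ refl) (y , inj₁ y∈)   = proj₂ new (y , y∈)
      lipschitz′ (x , inj₂ refl) (y , inj₂ _)    = ℕ.≤-trans (ℕ.≤-reflexive (Y.≈⇒0 Y.EqC.refl)) z≤n

    module _ (enum : ℕ ↠ X.Carrier) (φ : PartialMap) where
      open Surjection enum using (to; to⁻; to∘to⁻)

      stage : ℕ → PartialMap
      stage zero    = φ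
      stage (suc n) = extendAt (stage n) (to n)

      -- `≤′` raises its upper end one step at a time, just as `stage` grows, so `map-lift` holds by
      -- computation.
      lift : ∀ {m n x} → m ≤′ n → Dom (stage m) x → Dom (stage n) x
      lift ≤′-refl       x∈ = x∈
      lift (≤′-step m≤n) x∈ = inj₁ (lift m≤n x∈)

      map-lift : ∀ {m n x} (m≤n : m ≤′ n) (x∈ : Dom (stage m) x) →
                 map (stage n) (x , lift m≤n x∈) ≡ map (stage m) (x , x∈)
      map-lift ≤′-refl       x∈ = refl
      map-lift (≤′-step m≤n) x∈ = map-lift m≤n x∈

      -- Both points live in the later stage `m ⊔ n`, where their values are unchanged.
      stages-lipschitz : ∀ {m n x y} (x∈ : Dom (stage m) x) (y∈ : Dom (stage n) y) →
                         Y.d (map (stage m) (x , x∈)) (map (stage n) (y , y∈)) ≤ X.d x y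
      stages-lipschitz {m} {n} {x} {y} x∈ y∈ =
        subst₂ (λ u w → Y.d u w ≤ X.d x y) (map-lift m≤ x∈) (map-lift n≤ y∈)
               (lipschitz (stage (m ⊔ n)) (x , lift m≤ x∈) (y , lift n≤ y∈))
        where
        m≤ : m ≤′ m ⊔ n
        m≤ = ℕ.≤⇒≤′ (ℕ.m≤m⊔n m n)
        n≤ : n ≤′ m ⊔ n
        n≤ = ℕ.≤⇒≤′ (ℕ.m≤n⊔m m n)

      total : ∀ x → Dom (stage (suc (to⁻ x))) x
      total x = inj₂ (to∘to⁻ x)

  onePointExtension⇒Kirszbraun : ℕ ↠ X.Carrier → OnePointExtension X Y → Kirszbraun X Y
  onePointExtension⇒Kirszbraun enum extend S f lip =
    -- The value at `x` is read off right after the stage that processes its index `to⁻ x`.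
    (λ x → map (φ∞ (suc (to⁻ x))) (x , total′ x)) ,
    (λ x y → stages-lipschitz extend enum φ₀ {suc (to⁻ x)} {suc (to⁻ y)} (total′ x) (total′ y)) ,
    -- The values from stage 0 and from the later stage are compared at the same point `x`.
    (λ x x∈S → Y.0⇒≈ (ℕ.n≤0⇒n≡0 (ℕ.≤-trans
      (stages-lipschitz extend enum φ₀ {suc (to⁻ x)} {zero} (total′ x) x∈S)
      (ℕ.≤-reflexive (X.≈⇒0 X.EqC.refl)))))
    where
    open Surjection enum using (to⁻)
    φ₀ : PartialMap
    φ₀ = record { Dom = S ; map = f ; lipschitz = lip }
    φ∞ : ℕ → PartialMap
    φ∞ = stage extend enum φ₀
    total′ : ∀ x → Dom (φ∞ (suc (to⁻ x))) x
    total′ = total extend enum φ₀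

-- Enumeration of ℤ^d

-- Runs through each antidiagonal from `(s , 0)` to `(0 , s)`, then jumps to `(suc s , 0)`.
diagonal : ℕ → ℕ × ℕ
diagonal zero = 0 , 0
diagonal (suc n) with diagonal n
... | zero  , m = suc m , 0
... | suc k , m = k , suc m

-- The recursion traces the path backwards: `m` drops within an antidiagonal, and `s` drops on
-- passing to the previous one.
diagonal-surjective : ∀ s k m → k + m ≡ s → ∃[ n ] diagonal n ≡ (k , m)
diagonal-surjective s k (suc m) eq with diagonal-surjective s (suc k) m (trans (sym (ℕ.+-suc k m)) eq)
... | n , n↦ = suc n , step
  where
  step : diagonal (suc n) ≡ (k , suc m)
  step rewrite n↦ = refl
diagonal-surjective s       zero    zero eq = 0 , refl
diagonal-surjective (suc s) (suc k) zero eq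
  with diagonal-surjective s 0 k (trans (sym (ℕ.+-identityʳ k)) (ℕ.suc-injective eq))
... | n , n↦ = suc n , step
  where
  step : diagonal (suc n) ≡ (suc k , 0)
  step rewrite n↦ = refl

ℕ↠ℕ×ℕ : ℕ ↠ (ℕ × ℕ)
ℕ↠ℕ×ℕ = mk↠ₛ λ (k , m) → diagonal-surjective (k + m) k m refl

ℕ↠ℤ : ℕ ↠ ℤ
ℕ↠ℤ = mk↠ₛ {to = uncurry _⊖_} (λ { (+ n) → (n , 0) , refl ; -[1+ n ] → (0 , suc n) , refl }) ↠-∘ ℕ↠ℕ×ℕ

ℕ↠Vec : ∀ d → ℕ ↠ Vec ℤ d
ℕ↠Vec zero    = mk↠ₛ {to = λ _ → []} (λ { [] → 0 , refl })
ℕ↠Vec (suc d) = mk↠ₛ {to = uncurry _∷_} (λ { (i ∷ x) → (i , x) , refl }) ↠-∘ ((ℕ↠ℤ ×-↠ ℕ↠Vec d) ↠-∘ ℕ↠ℕ×ℕ)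

-- Finite bases of subsets of ℤ^d

-- a lies on a geodesic from b to x.
Dominates : Vec ℤ d → Vec ℤ d → Vec ℤ d → Set
Dominates b x a = l1 b a + l1 a x ≤ l1 b x

-- Members come from `S`, but only the part `T` must be dominated; so bases of the pieces of `S` can
-- be joined.
record Basis (b : Vec ℤ d) (S T : Pred (Vec ℤ d) 0ℓ) : Set where
  constructor _,_
  field
    members   : List (Σ (Vec ℤ d) S)
    dominated : ∀ x → T x → Any (Dominates b x ∘ proj₁) members

dominates-∷ : ∀ i j k (b a x : Vec ℤ d) → δ i j + δ j k ≡ δ i k → Dominates b x a →
              Dominates (i ∷ b) (k ∷ x) (j ∷ a)
dominates-∷ i j k b a x eq dom =
  subst (_≤ δ i k + l1 b x) (interchange (δ i j) (δ j k) (l1 b a) (l1 a x))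
        (ℕ.+-mono-≤ (ℕ.≤-reflexive eq) dom)

basis-∪ : {b : Vec ℤ d} {S T T′ : Pred (Vec ℤ d) 0ℓ} →
          Basis b S T → Basis b S T′ → Basis b S (λ x → T x ⊎ T′ x)
basis-∪ (F , F-basis) (F′ , F′-basis) =
  F ++ F′ , λ x → [ Any.++⁺ˡ ∘ F-basis x , Any.++⁺ʳ F ∘ F′-basis x ]′

basis-⊆ : {b : Vec ℤ d} {S T T′ : Pred (Vec ℤ d) 0ℓ} → (∀ {x} → T′ x → T x) → Basis b S T → Basis b S T′
basis-⊆ T′⊆T (F , F-basis) = F , λ x → F-basis x ∘ T′⊆T

Ray : (ℕ → ℤ) → Pred (Vec ℤ (suc d)) 0ℓ → Pred ℕ 0ℓ → Pred (Vec ℤ (suc d)) 0ℓ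
Ray h S N (j ∷ x) = ∃[ n ] (N n × j ≡ h n × S (j ∷ x))

-- The induction step of Dickson's lemma along a ray h of the first coordinate:
-- a finite basis of the projection reaches only up to some h m, and the
-- finitely many slices below h m have finite bases of their own.
module _ {i : ℤ} {b : Vec ℤ d} (basis : ∀ S → Basis b S S)
         (h : ℕ → ℤ) (ray : ∀ {m n} → m ≤ n → δ i (h m) + δ (h m) (h n) ≡ δ i (h n))
         (S : Pred (Vec ℤ (suc d)) 0ℓ) where

  slice-basis : ∀ n → Basis (i ∷ b) S (Ray h S (_≡ n))
  slice-basis n with basis (S ∘ (h n ∷_))
  ... | F , F-basis = List.map (λ (a , a∈) → h n ∷ a , a∈) F , λ where
    (_ ∷ x) (_ , refl , refl , x∈) →
      Any.map⁺ (Any.map (λ {(a , _)} → dominates-∷ i (h n) (h n) b a x (ray (ℕ.≤-refl {n}))) (F-basis x x∈))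

  slices-basis : ∀ m → Basis (i ∷ b) S (Ray h S (_< m))
  slices-basis zero    = [] , λ { (_ ∷ _) (_ , () , _) }
  slices-basis (suc m) = basis-⊆ split (basis-∪ (slices-basis m) (slice-basis m))
    where
    split : ∀ {x} → Ray h S (_< suc m) x → Ray h S (_< m) x ⊎ Ray h S (_≡ m) x
    split {_ ∷ _} (n , n<1+m , x∈) with ℕ.m≤n⇒m<n∨m≡n (ℕ.≤-pred n<1+m)
    ... | inj₁ n<m = inj₁ (n , n<m , x∈)
    ... | inj₂ n≡m = inj₂ (n , n≡m , x∈)

  far-basis : ∃[ m ] Basis (i ∷ b) S (Ray h S (m ≤_))
  far-basis with basis (λ x → ∃[ n ] S (h n ∷ x))
  ... | F , F-basis = m , List.map (λ (a , n , a∈) → h n ∷ a , a∈) F , λ { (_ ∷ x) (n , m≤n , refl , x∈) →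
    let ((a , k , _) , f∈F , dom) = find (F-basis x (n , x∈))
    -- Since `k ≤ m ≤ n`, the height `h k` lies on the ray between `i` and `h n`.
    in Any.map⁺ (lose f∈F (dominates-∷ i (h k) (h n) b a x
         (ray (ℕ.≤-trans (All.lookup heights≤m f∈F) m≤n)) dom)) }
    where
    height : Σ (Vec ℤ d) (λ x → ∃[ n ] S (h n ∷ x)) → ℕ
    height (_ , n , _) = n
    m : ℕ
    m = Extrema.max 0 (List.map height F)
    heights≤m : All (λ f → height f ≤ m) F
    heights≤m = All.map⁻ (Extrema.xs≤max 0 (List.map height F))

  ray-basis : Basis (i ∷ b) S (Ray h S U)
  ray-basis with far-basis
  ... | m , far = basis-⊆ split (basis-∪ far (slices-basis m))
    where
    split : ∀ {x} → Ray h S U x → Ray h S (m ≤_) x ⊎ Ray h S (_< m) x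
    split {_ ∷ _} (n , _ , x∈) with ℕ.≤-<-connex m n
    ... | inj₁ m≤n = inj₁ (n , m≤n , x∈)
    ... | inj₂ n<m = inj₂ (n , n<m , x∈)

finite-basis : ExcludedMiddle 0ℓ → (b : Vec ℤ d) (S : Pred (Vec ℤ d) 0ℓ) → Basis b S S
finite-basis em [] S with em {S []}
... | yes []∈ = ([] , []∈) ∷ [] , λ { [] _ → here z≤n }
... | no  []∉ = [] , λ { [] []∈ → contradiction []∈ []∉ }
-- The first coordinate is split at `i` into an upward and a downward ray; along each, points move
-- monotonically away from `i`.
finite-basis em (i ∷ b) S = basis-⊆ split (basis-∪ (ray-basis basis up′ up-ray S) (ray-basis basis down down-ray S))
  where
  basis : ∀ S → Basis b S S
  basis = finite-basis em b
  up′ down : ℕ → ℤ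
  up′ n  = i ℤ.+ + n
  down n = i ℤ.- + n
  up-ray : ∀ {m n} → m ≤ n → δ i (up′ m) + δ (up′ m) (up′ n) ≡ δ i (up′ n)
  up-ray {m} m≤n = δ-between (inj₁ (ℤ.i≤i+j i (+ m) , ℤ.+-monoʳ-≤ i (ℤ.+≤+ m≤n)))
  down-ray : ∀ {m n} → m ≤ n → δ i (down m) + δ (down m) (down n) ≡ δ i (down n)
  down-ray {m} m≤n = δ-between (inj₂ (ℤ.+-monoʳ-≤ i (ℤ.neg-mono-≤ (ℤ.+≤+ m≤n)) , ℤ.i-j≤i i (+ m)))
  i+[j-i] : ∀ j → j ≡ i ℤ.+ (j ℤ.- i)
  i+[j-i] j = sym (trans (ℤ.+-comm i (j ℤ.- i)) (trans (ℤ.+-assoc j (- i) i)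
                (trans (cong (λ u → j ℤ.+ u) (ℤ.+-inverseˡ i)) (ℤ.+-identityʳ j))))
  split : ∀ {x} → S x → Ray up′ S U x ⊎ Ray down S U x
  split {j ∷ x} x∈ with j ℤ.- i | i+[j-i] j
  ... | + n      | eq = inj₁ (n , _ , eq , x∈)
  ... | -[1+ n ] | eq = inj₂ (suc n , _ , eq , x∈)

-- Extending finite families by one point

-- The order is a parameter so that the flipped order yields minima.
maximum : {R : Rel A e} → Total R → Transitive R → (f : Fin (suc n) → A) → ∃[ k ] (∀ i → R (f i) (f k))
maximum {n = zero}  total R-trans f = zero , λ { zero → Sum.reduce (total (f zero) (f zero)) }
maximum {n = suc n} total R-trans f with maximum total R-trans (f ∘ suc)
... | k , max with total (f zero) (f (suc k))
...   | inj₁ f₀≤fₖ = suc k , λ { zero → f₀≤fₖ ; (suc i) → max i }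
...   | inj₂ fₖ≤f₀ = zero , λ { zero → Sum.reduce (total (f zero) (f zero))
                              ; (suc i) → R-trans (max i) fₖ≤f₀ }

-- A choice of preimages for all elements would inject the larger set into the smaller one.
¬surjective : ∀ {m n} → m < n → (h : Fin m → Fin n) → ∃[ k ] (∀ j → h j ≢ k)
¬surjective m<n h with Fin.¬∀⟶∃¬ _ (λ k → ∃[ j ] h j ≡ k) (λ k → Fin.any? (λ j → h j Fin.≟ k)) no-section
  where
  no-section : ¬ (∀ k → ∃[ j ] h j ≡ k)
  no-section g = ℕ.<⇒≱ m<n (Fin.injective⇒≤ {f = proj₁ ∘ g}
    (λ {k} {l} eq → trans (sym (proj₂ (g k))) (trans (cong h eq) (proj₂ (g l)))))
... | k , ∄ = k , λ j hj≡k → ∄ (j , hj≡k)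

-- Coordinates are replaced from the last to the first, so coordinate `j` still has its original
-- value when its turn comes.
[]≔-induction : (P : Pred (Vec A d) p) (x : Vec A d) →
                (∀ y j i → lookup y j ≡ lookup x j → P y → P (y [ j ]≔ i)) → P x → ∀ y → P y
[]≔-induction P []      step Px []      = Px
[]≔-induction P (k ∷ x) step Px (i ∷ y) =
  step (k ∷ y) zero i refl
    ([]≔-induction (P ∘ (k ∷_)) x (λ z j l → step (k ∷ z) (suc j) l) Px y)

module _ (Y : Metric a ℓ₁) (d : ℕ) where
  private
    module Y = Metric Y
    Value : Set a
    Value = Vec ℤ d × Y.Carrier

  Compatible : Value → Value → Set
  Compatible (x , y) (x′ , y′) = Y.d y y′ ≤ l1 x x′

  Extends : (Fin n → Value) → Vec ℤ d → Set a
  Extends q x = ∃[ y ] (∀ i → Compatible (x , y) (q i))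

  Extensible : ℕ → Set a
  Extensible n = (q : Fin n → Value) → (∀ i j → Compatible (q i) (q j)) → ∀ x → Extends q x

  compatible-refl : ∀ p → Compatible p p
  compatible-refl _ = ℕ.≤-trans (ℕ.≤-reflexive (Y.≈⇒0 Y.EqC.refl)) z≤n

  compatible-sym : ∀ p q → Compatible p q → Compatible q p
  compatible-sym (x , y) (x′ , y′) = subst₂ _≤_ (Y.sym y y′) (l1-sym x x′)

  -- If `q` lies on a geodesic from `p` to `r`, the constraint at `r` follows from the one at `q`.
  compatible-trans : ∀ p q r → Dominates (proj₁ p) (proj₁ r) (proj₁ q) →
                     Compatible p q → Compatible q r → Compatible p r
  compatible-trans (_ , y) (_ , y′) (_ , y″) dom pq qr =
    ℕ.≤-trans (Y.triangle y y′ y″) (ℕ.≤-trans (ℕ.+-mono-≤ pq qr) dom)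

  -- A point x lying on geodesics from x′ to two points of the family makes
  -- both of them redundant for an extension to x′.
  swap-two-for-one : Extensible n → (q : Fin (suc n) → Value) → (∀ i j → Compatible (q i) (q j)) →
                     ∀ {k t} → k ≢ t → ∀ x x′ → Dominates x′ (proj₁ (q k)) x → Dominates x′ (proj₁ (q t)) x →
                     Extends q x → Extends q x′
  swap-two-for-one ext q compat {k} {t} k≢t x x′ domₖ domₜ (y , y-ok)
    -- The new value `(x , y)` overwrites entry `t` and entry `k` is dropped, leaving `n` values.
    with ext (Vector.removeAt q′ k) (λ i j → compat′ (punchIn k i) (punchIn k j)) x′
    where
    q′ : Fin (suc _) → Value
    q′ = Vector.updateAt q t (const (x , y))
    new-or-old : ∀ i → q′ i ≡ (x , y) ⊎ q′ i ≡ q i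
    new-or-old i with i Fin.≟ t
    ... | yes refl = inj₁ (Vector.updateAt-updates i q)
    ... | no  i≢t  = inj₂ (Vector.updateAt-minimal i t q i≢t)
    compat′ : ∀ i j → Compatible (q′ i) (q′ j)
    compat′ i j with new-or-old i | new-or-old j
    ... | inj₁ eq | inj₁ eq′ = subst₂ Compatible (sym eq) (sym eq′) (compatible-refl (x , y))
    ... | inj₁ eq | inj₂ eq′ = subst₂ Compatible (sym eq) (sym eq′) (y-ok j)
    ... | inj₂ eq | inj₁ eq′ = subst₂ Compatible (sym eq) (sym eq′) (compatible-sym (x , y) (q i) (y-ok i))
    ... | inj₂ eq | inj₂ eq′ = subst₂ Compatible (sym eq) (sym eq′) (compat i j)
  ... | y′ , y′-ok = y′ , ok
    where
    kept : ∀ {i} → k ≢ i → Compatible (x′ , y′) (Vector.updateAt q t (const (x , y)) i)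
    kept k≢i = subst (λ i → Compatible (x′ , y′) (Vector.updateAt q t (const (x , y)) i))
                     (Fin.punchIn-punchOut k≢i) (y′-ok (punchOut k≢i))
    near-x : Compatible (x′ , y′) (x , y)
    near-x = subst (Compatible (x′ , y′)) (Vector.updateAt-updates t q) (kept k≢t)
    ok : ∀ i → Compatible (x′ , y′) (q i)
    ok i with k Fin.≟ i | i Fin.≟ t
    -- The dropped and the overwritten entry are both controlled through `x`.
    ... | yes refl | _        = compatible-trans (x′ , y′) (x , y) (q i) domₖ near-x (y-ok i)
    ... | no _     | yes refl = compatible-trans (x′ , y′) (x , y) (q i) domₜ near-x (y-ok i)
    ... | no k≢i   | no i≢t   =
      subst (Compatible (x′ , y′)) (Vector.updateAt-minimal i t q i≢t) (kept k≢i)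

  extensible-suc : 2 * d ≤ n → Extensible n → Extensible (suc n)
  extensible-suc {n} 2d≤n ext q compat = []≔-induction (Extends q) (proj₁ (q k)) move (proj₂ (q k) , compat k)
    where
    coordinate : Fin d → Fin (suc n) → ℤ
    coordinate j i = lookup (proj₁ (q i)) j
    top : ∀ j → ∃[ t ] (∀ i → coordinate j i ℤ.≤ coordinate j t)
    top j = maximum ℤ.≤-total ℤ.≤-trans (coordinate j)
    bottom : ∀ j → ∃[ t ] (∀ i → coordinate j t ℤ.≤ coordinate j i)
    bottom j = maximum {R = flip ℤ._≤_} (flip ℤ.≤-total) (flip ℤ.≤-trans) (coordinate j)
    extreme : Fin 2 × Fin d → Fin (suc n)
    extreme (zero  , j) = proj₁ (top j)
    extreme (suc _ , j) = proj₁ (bottom j)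
    -- There are `suc n` indices, more than the `2 * d` extreme ones.
    inner : ∃[ k ] (∀ s → extreme (remQuot {2} d s) ≢ k)
    inner = ¬surjective (s≤s 2d≤n) (extreme ∘ remQuot {2} d)
    k : Fin (suc n)
    k = proj₁ inner
    k≢extreme : ∀ s j → k ≢ extreme (s , j)
    k≢extreme s j eq = proj₂ inner (combine s j) (trans (cong extreme (Fin.remQuot-combine s j)) (sym eq))
    dominates : ∀ x j i t → Between i (lookup x j) (coordinate j t) → Dominates (x [ j ]≔ i) (proj₁ (q t)) x
    dominates x j i t = ℕ.≤-reflexive ∘ l1-[]≔ x (proj₁ (q t)) j
    move : ∀ x j i → lookup x j ≡ coordinate j k → Extends q x → Extends q (x [ j ]≔ i)
    move x j i xⱼ≡kⱼ with ℤ.≤-total i (lookup x j)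
    -- A decreasing move leaves `x` between its successor and both `q k` and the top entry, since
    -- their coordinates are at least that of `x`; an increasing move uses the bottom entry.
    ... | inj₁ i≤xⱼ = swap-two-for-one ext q compat (k≢extreme zero j) x (x [ j ]≔ i)
      (dominates x j i k (inj₁ (i≤xⱼ , ℤ.≤-reflexive xⱼ≡kⱼ)))
      (dominates x j i (extreme (zero , j)) (inj₁ (i≤xⱼ , ℤ.≤-trans (ℤ.≤-reflexive xⱼ≡kⱼ) (proj₂ (top j) k))))
    ... | inj₂ xⱼ≤i = swap-two-for-one ext q compat (k≢extreme (suc zero) j) x (x [ j ]≔ i)
      (dominates x j i k (inj₂ (ℤ.≤-reflexive (sym xⱼ≡kⱼ) , xⱼ≤i)))
      (dominates x j i (extreme (suc zero , j)) (inj₂ (ℤ.≤-trans (proj₂ (bottom j) k) (ℤ.≤-reflexive (sym xⱼ≡kⱼ)) , xⱼ≤i)))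

  -- A smaller family is padded by repeating its first value; `y₀` serves the empty family.
  extensible-pred : Y.Carrier → Extensible (suc n) → Extensible n
  extensible-pred {zero}  y₀ ext q compat x = y₀ , λ ()
  extensible-pred {suc n} y₀ ext q compat x with ext (q ∘ pinch zero) (λ i j → compat (pinch zero i) (pinch zero j)) x
  ... | y , y-ok = y , λ i → y-ok (suc i)

  -- The value at `x` is a common point of the balls around the given values with radii the
  -- distances to `x`; the triangle inequality through `x` gives the pairwise bounds.
  pairwiseHelly⇒extensible-2d : PairwiseHelly (2 * d) Y → Extensible (2 * d)
  pairwiseHelly⇒extensible-2d helly q compat x = helly (proj₂ ∘ q) (λ i → l1 x (proj₁ (q i))) λ i j →
    ℕ.≤-trans (compat i j) (ℕ.≤-trans (l1-triangle (proj₁ (q i)) x (proj₁ (q j)))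
      (ℕ.+-monoˡ-≤ _ (ℕ.≤-reflexive (l1-sym (proj₁ (q i)) x))))

  pairwiseHelly⇒extensible : PairwiseHelly (2 * d) Y → Y.Carrier → ∀ n → Extensible n
  pairwiseHelly⇒extensible helly y₀ n =
    [ (λ n≤2d → down (ℕ.≤⇒≤′ n≤2d) (pairwiseHelly⇒extensible-2d helly)) , up′ ∘ ℕ.≤⇒≤′ ]′ (ℕ.≤-total n (2 * d))
    where
    down : ∀ {m n} → m ≤′ n → Extensible n → Extensible m
    down ≤′-refl       ext = ext
    down (≤′-step m≤n) ext = down m≤n (extensible-pred y₀ ext)
    up′ : ∀ {n} → 2 * d ≤′ n → Extensible n
    up′ ≤′-refl        = pairwiseHelly⇒extensible-2d helly
    up′ (≤′-step 2d≤n) = extensible-suc (ℕ.≤′⇒≤ 2d≤n) (up′ 2d≤n)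

  extensible⇒onePointExtension : (em : ∀ ℓ → ExcludedMiddle ℓ) → (∀ n → Extensible n) →
                                 OnePointExtension (pathMetric em (ℤ^ d)) Y
  extensible⇒onePointExtension em ext S f lip x = y , ok
    where
    open Basis (finite-basis (em 0ℓ) x S) renaming (members to F)
    value : Σ (Vec ℤ d) S → Value
    value s = proj₁ s , f s
    compat : ∀ s t → Compatible (value s) (value t)
    compat s t = subst (Y.d (f s) (f t) ≤_) (dist≡l1 em (proj₁ s) (proj₁ t)) (lip s t)
    -- Compatibility with the finite basis seen from `x` suffices: each point of `S` is dominated by
    -- a member.
    extension : Extends (value ∘ List.lookup F) x
    extension = ext (List.length F) (value ∘ List.lookup F) (λ i j → compat (List.lookup F i) (List.lookup F j)) x
    y : Y.Carrier
    y = proj₁ extension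
    ok : ∀ s → Y.d y (f s) ≤ dist em (ℤ^ d) x (proj₁ s)
    ok s@(a , a∈S) = subst (Y.d y (f s) ≤_) (sym (dist≡l1 em x a))
      (compatible-trans (x , y) (value t) (value s)
        (Any.lookup-index dom) (proj₂ extension (Any.index dom)) (compat t s))
      where
      dom : Any (Dominates x a ∘ proj₁) F
      dom = dominated a a∈S
      t : Σ (Vec ℤ d) S
      t = List.lookup F (Any.index dom)

-- Points on the coordinate axes

axis : Fin d → ℤ → Vec ℤ d
axis j i = replicate _ 0ℤ [ j ]≔ i

l1-0-axis : (j : Fin d) (i : ℤ) → l1 (replicate d 0ℤ) (axis j i) ≡ ℤ.∣ i ∣
l1-0-axis {suc d} zero i = trans (cong₂ _+_ (trans (ℤ.∣i-j∣≡∣j-i∣ 0ℤ i) (cong ℤ.∣_∣ (ℤ.+-identityʳ i)))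
                                            (l1-refl (replicate d 0ℤ)))
                                 (ℕ.+-identityʳ ℤ.∣ i ∣)
l1-0-axis (suc j) i = l1-0-axis j i

l1-axis-same : (j : Fin d) (i k : ℤ) → l1 (axis j i) (axis j k) ≡ δ i k
l1-axis-same {suc d} zero i k = trans (cong (λ m → δ i k + m) (l1-refl (replicate d 0ℤ))) (ℕ.+-identityʳ _)
l1-axis-same (suc j) i k = l1-axis-same j i k

l1-axis-distinct : {j l : Fin d} → j ≢ l → ∀ i k → l1 (axis j i) (axis l k) ≡ ℤ.∣ i ∣ + ℤ.∣ k ∣
l1-axis-distinct {j = zero}  {zero}  j≢l i k = contradiction refl j≢l
l1-axis-distinct {j = zero}  {suc l} j≢l i k = cong₂ _+_ (cong ℤ.∣_∣ (ℤ.+-identityʳ i)) (l1-0-axis l k)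
l1-axis-distinct {j = suc j} {zero}  j≢l i k =
  trans (l1-sym (axis (suc j) i) (axis zero k)) (trans (l1-axis-distinct (j≢l ∘ sym) k i) (ℕ.+-comm ℤ.∣ k ∣ ℤ.∣ i ∣))
l1-axis-distinct {j = suc j} {suc l} j≢l i k = l1-axis-distinct (j≢l ∘ cong suc) i k

signed : Fin 2 → ℕ → ℤ
signed zero    r = + r
signed (suc _) r = - + r

∣signed∣ : ∀ s r → ℤ.∣ signed s r ∣ ≡ r
∣signed∣ zero    r = refl
∣signed∣ (suc _) r = ℤ.∣-i∣≡∣i∣ (+ r)

δ-opposite : ∀ {s t} → s ≢ t → ∀ r r′ → δ (signed s r) (signed t r′) ≡ r + r′
δ-opposite {zero}     {zero}     s≢t r r′ = contradiction refl s≢t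
δ-opposite {zero}     {suc zero} s≢t r r′ = cong ℤ.∣_∣ (cong (λ u → + r ℤ.+ u) (ℤ.neg-involutive (+ r′)))
δ-opposite {suc zero} {zero}     s≢t r r′ =
  trans (cong ℤ.∣_∣ (sym (ℤ.neg-distrib-+ (+ r) (+ r′)))) (ℤ.∣-i∣≡∣i∣ (+ (r + r′)))
δ-opposite {suc zero} {suc zero} s≢t r r′ = contradiction refl s≢t

-- The origin lies on a geodesic between points of different half-axes: they have opposite signs on
-- one axis or lie on two axes.
l1-axes : {p q : Fin 2 × Fin d} → p ≢ q → ∀ r r′ →
          l1 (axis (proj₂ p) (signed (proj₁ p) r)) (axis (proj₂ q) (signed (proj₁ q) r′)) ≡ r + r′
l1-axes {p = s , j} {t , l} p≢q r r′ with j Fin.≟ l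
... | yes refl = trans (l1-axis-same j (signed s r) (signed t r′)) (δ-opposite (p≢q ∘ cong (_, j)) r r′)
... | no j≢l   = trans (l1-axis-distinct j≢l (signed s r) (signed t r′)) (cong₂ _+_ (∣signed∣ s r) (∣signed∣ t r′))

-- From Lipschitz extension to common points of balls

Kirszbraun⇒pairwiseHelly : (em : ∀ ℓ → ExcludedMiddle ℓ) (d : ℕ) (Y : Metric a ℓ₁) →
                           Kirszbraun (pathMetric em (ℤ^ d)) Y → PairwiseHelly (2 * d) Y
Kirszbraun⇒pairwiseHelly {a = a} em d Y kirszbraun c r close = g origin , near
  where
  module Y = Metric Y
  origin : Vec ℤ d
  origin = replicate d 0ℤ
  index : Fin (2 * d) → Fin 2 × Fin d
  index = remQuot {2} d
  point : Fin (2 * d) → Vec ℤ d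
  point i = axis (proj₂ (index i)) (signed (proj₁ (index i)) (r i))
  index-injective : ∀ {i j} → index i ≡ index j → i ≡ j
  index-injective {i} {j} eq =
    trans (sym (Fin.combine-remQuot {2} d i)) (trans (cong (uncurry combine) eq) (Fin.combine-remQuot {2} d j))
  S : Pred (Vec ℤ d) 0ℓ
  S x = ∃[ i ] point i ≡ x
  f : Σ (Vec ℤ d) S → Y.Carrier
  -- Points of radius 0 coincide at the origin; the index in the membership selects the centre, and
  -- `close` puts such centres at distance 0.
  f (_ , i , _) = c i
  lip : 1-Lipschitz (dist em (ℤ^ d) on proj₁) Y.d f
  lip (_ , i , refl) (_ , j , refl) with i Fin.≟ j
  ... | yes refl = ℕ.≤-trans (ℕ.≤-reflexive (Y.≈⇒0 Y.EqC.refl)) z≤n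
  ... | no  i≢j  = ℕ.≤-trans (close i j) (ℕ.≤-reflexive (sym
    (trans (dist≡l1 em (point i) (point j)) (l1-axes (i≢j ∘ index-injective) (r i) (r j)))))
  extension : Σ[ g ∈ (Vec ℤ d → Y.Carrier) ]
                1-Lipschitz (dist em (ℤ^ d)) Y.d g × (∀ x (x∈S : S x) → g x Y.≈ f (x , x∈S))
  extension = kirszbraun S f lip
  g : Vec ℤ d → Y.Carrier
  g = proj₁ extension
  near : ∀ i → Y.d (g origin) (c i) ≤ r i
  near i = subst₂ _≤_
    (Y.cong Y.EqC.refl (proj₂ (proj₂ extension) (point i) (i , refl)))
    (trans (dist≡l1 em origin (point i))
      (trans (l1-0-axis (proj₂ (index i)) (signed (proj₁ (index i)) (r i))) (∣signed∣ (proj₁ (index i)) (r i))))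
    (proj₁ (proj₂ extension) origin (point i))

theorem1p1 : ∀ {v e} (em : ∀ ℓ → ExcludedMiddle ℓ) (d : ℕ) → 1 ≤ d → (H : Graph v e) →
    Kirszbraun (pathMetric em (ℤ^ d)) (pathMetric em H) ⇔ Helly (2 * d) 2 (pathMetric em H)
theorem1p1 em d _ H = mk⇔
  (λ kirszbraun → pairwiseHelly⇒Helly (pathMetric em H)
    (Kirszbraun⇒pairwiseHelly em d (pathMetric em H) kirszbraun))
  (λ helly → onePointExtension⇒Kirszbraun (pathMetric em (ℤ^ d)) (pathMetric em H) (ℕ↠Vec d)
    (extensible⇒onePointExtension (pathMetric em H) d em
      (pairwiseHelly⇒extensible (pathMetric em H) d (Helly⇒pairwiseHelly em H helly) (Graph.nonempty H))))
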